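{- Let $G=(V,E)$ be a graph, let $L^2(G)=(E,L^2(E))$ be the square of its line graph, and let $\sigma$ be an ordering of $V$. Let $\sigma^{*}$ be the graph $L^2(G)$ with its vertex set $E$ totally ordered by the $\star$ rule: for distinct edges $e_i=ab$ and $e_j=uv$ of $G$, written so that $a\prec_\sigma b$ and $u\prec_\sigma v$, one has $e_i\prec_{\sigma^{*}} e_j$ if and only if either $a\prec_\sigma u$, or $a=u$ and $b\prec_\sigma v$. Then for each of the five patterns $p_i$, $i\in\{1,2,3,4,5\}$: if $\sigma$ is $p_i$-free (with respect to $G$), then $\sigma^{*}$ is $p_i$-free (with respect to $L^2(G)$).
   Context: All graphs are finite and simple. An ordering of $V$ with $|V|=n$ is a bijection $\sigma:V\to\{1,\dots,n\}$; $u\prec_\sigma v$ means $\sigma(u)<\sigma(v)$. The line graph $L(G)$ has vertex set $E$, two distinct edges of $G$ being adjacent iff they share an endpoint. The square $H^2$ of a graph $H$ has the same vertex set as $H$, and two distinct vertices are adjacent in $H^2$ iff their distance in $H$ is at most $2$. $L^2(G)=(L(G))^2$. Equivalently, two distinct edges $e,f$ of $G$ are adjacent in $L^2(G)$ iff they share an endpoint or some edge of $G$ joins an endpoint of $e$ to an endpoint of $f$; they are non-adjacent iff they induce a $2K_2$ in $G$. Patterns on three vertices. Let $H$ be a graph with a total order $\prec$ on its vertices. Three vertices $x\prec y\prec z$ induce, in $H$: - $p_1$ if $xz,yz$ are edges and $xy$ is not an edge; - $p_2$ if $xy$ is an edge and $xz,yz$ are not edges; - $p_3$ if $yz$ is an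 edge and $xy,xz$ are not edges; - $p_4$ if $xz$ is an edge and $xy,yz$ are not edges; - $p_5$ if none of $xy,xz,yz$ is an edge. The order $\prec$ is $p_i$-free with respect to $H$ if no three vertices $x\prec y\prec z$ of $H$ induce $p_i$. -}

module Defs where

open import Level using (Level; suc; _⊔_; 0ℓ)
open import Data.Nat.Base as ℕ using (ℕ)
open import Data.Fin.Base as Fin using (Fin)
import Data.Fin.Properties as Fin
open import Data.Product.Base using (∃-syntax; _×_; _,_; proj₁; proj₂)
open import Data.Sum.Base using (_⊎_; inj₁; inj₂)
open import Function.Base using (_∘_)
open import Function.Bundles using (Bijection)
open import Relation.Binary.Bundles using (Setoid)
open import Relation.Binary.Core using (Rel)
open import Relation.Binary.Definitions
  using (Symmetric; Irreflexive; Transitive; Trichotomous; Tri; tri<; tri≈; tri>; _Respects₂_)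
open import Relation.Binary.Structures using (IsEquivalence; IsStrictTotalOrder)
import Relation.Binary.PropositionalEquality as ≡
open import Relation.Nullary using (¬_; contradiction)

-- Vertices form a setoid because the edges of a graph, which are the vertices
-- of its line graph, are unordered pairs.
record SimpleGraph (c ℓ a : Level) : Set (suc (c ⊔ ℓ ⊔ a)) where
  infix 4 _~_
  field
    vertices : Setoid c ℓ
  open Setoid vertices public renaming (Carrier to V)
  field
    _~_      : Rel V a
    ~-resp-≈ : _~_ Respects₂ _≈_
    ~-sym    : Symmetric _~_
    ~-irrefl : Irreflexive _≈_ _~_

module _ {c ℓ a : Level} (G : SimpleGraph c ℓ a) where
  open SimpleGraph G

  record Edge : Set (c ⊔ a) where
    constructor edge
    field
      {end₁ end₂} : V
      adjacent    : end₁ ~ end₂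

  open Edge

  -- The edge e is the unordered pair uv.
  HasEnds : Edge → V → V → Set ℓ
  HasEnds e u v = (end₁ e ≈ u × end₂ e ≈ v) ⊎ (end₁ e ≈ v × end₂ e ≈ u)

  infix 4 _≈ₑ_
  _≈ₑ_ : Rel Edge ℓ
  e ≈ₑ f = HasEnds e (end₁ f) (end₂ f)

  ends-resp-≈ₑ : ∀ e f {u v} → e ≈ₑ f → HasEnds f u v → HasEnds e u v
  ends-resp-≈ₑ _ _ (inj₁ (p , q)) (inj₁ (r , s)) = inj₁ (trans p r , trans q s)
  ends-resp-≈ₑ _ _ (inj₁ (p , q)) (inj₂ (r , s)) = inj₂ (trans p r , trans q s)
  ends-resp-≈ₑ _ _ (inj₂ (p , q)) (inj₁ (r , s)) = inj₂ (trans p s , trans q r)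
  ends-resp-≈ₑ _ _ (inj₂ (p , q)) (inj₂ (r , s)) = inj₁ (trans p s , trans q r)

  ≈ₑ-sym : ∀ e f → e ≈ₑ f → f ≈ₑ e
  ≈ₑ-sym _ _ (inj₁ (p , q)) = inj₁ (sym p , sym q)
  ≈ₑ-sym _ _ (inj₂ (p , q)) = inj₂ (sym q , sym p)

  ≈ₑ-isEquivalence : IsEquivalence _≈ₑ_
  ≈ₑ-isEquivalence = record
    { refl  = inj₁ (refl , refl)
    ; sym   = λ {e} {f} → ≈ₑ-sym e f
    ; trans = λ {e} {f} → ends-resp-≈ₑ e f
    }

  edges : Setoid (c ⊔ a) ℓ
  edges = record { isEquivalence = ≈ₑ-isEquivalence }

  infix 4 _isEndOf_
  _isEndOf_ : V → Edge → Set ℓ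
  w isEndOf e = w ≈ end₁ e ⊎ w ≈ end₂ e

  isEndOf-resp-≈ₑ : ∀ {w} e f → e ≈ₑ f → w isEndOf e → w isEndOf f
  isEndOf-resp-≈ₑ _ _ (inj₁ (p , q)) (inj₁ r) = inj₁ (trans r p)
  isEndOf-resp-≈ₑ _ _ (inj₁ (p , q)) (inj₂ r) = inj₂ (trans r q)
  isEndOf-resp-≈ₑ _ _ (inj₂ (p , q)) (inj₁ r) = inj₂ (trans r p)
  isEndOf-resp-≈ₑ _ _ (inj₂ (p , q)) (inj₂ r) = inj₁ (trans r q)

  lineGraph : SimpleGraph (c ⊔ a) ℓ (c ⊔ ℓ)
  lineGraph = record
    { vertices = edges
    ; _~_      = λ e f → ¬ (e ≈ₑ f) × ∃[ w ] (w isEndOf e × w isEndOf f)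
    ; ~-resp-≈ =
        (λ {e} {f} {g} p (d , w , i , j) →
          (λ q → d (ends-resp-≈ₑ e g q (≈ₑ-sym f g p))) , w , i , isEndOf-resp-≈ₑ f g p j)
      , (λ {e} {f} {g} p (d , w , i , j) →
          (λ q → d (ends-resp-≈ₑ f g p q)) , w , isEndOf-resp-≈ₑ f g p i , j)
    ; ~-sym    = λ {e} {f} (d , w , i , j) → (λ q → d (≈ₑ-sym f e q)) , w , j , i
    ; ~-irrefl = λ p (d , _) → d p
    }

  infixr 5 _∷_
  data Walk : V → V → ℕ → Set (c ⊔ ℓ ⊔ a) where
    []  : ∀ {u v} → u ≈ v → Walk u v 0
    _∷_ : ∀ {u v w k} → u ~ v → Walk v w k → Walk u w (ℕ.suc k)

  -- The distance is the least length of a walk, so it is at most d precisely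
  -- when there is a walk of length at most d.
  DistanceAtMost : ℕ → Rel V (c ⊔ ℓ ⊔ a)
  DistanceAtMost d u v = ∃[ k ] (k ℕ.≤ d × Walk u v k)

  walk-respʳ : ∀ {u v w k} → v ≈ w → Walk u v k → Walk u w k
  walk-respʳ p ([] q)  = [] (trans q p)
  walk-respʳ p (s ∷ t) = s ∷ walk-respʳ p t

  walk-respˡ : ∀ {u v w k} → v ≈ w → Walk v u k → Walk w u k
  walk-respˡ p ([] q)  = [] (trans (sym p) q)
  walk-respˡ p (s ∷ t) = proj₂ ~-resp-≈ p s ∷ t

  walk-snoc : ∀ {u v w k} → Walk u v k → v ~ w → Walk u w (ℕ.suc k)
  walk-snoc ([] q)  r = proj₂ ~-resp-≈ (sym q) r ∷ [] refl
  walk-snoc (s ∷ t) r = s ∷ walk-snoc t r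

  walk-reverse : ∀ {u v k} → Walk u v k → Walk v u k
  walk-reverse ([] q)  = [] (sym q)
  walk-reverse (s ∷ t) = walk-snoc (walk-reverse t) (~-sym s)

  square : SimpleGraph c ℓ (c ⊔ ℓ ⊔ a)
  square = record
    { vertices = vertices
    ; _~_      = λ u v → ¬ (u ≈ v) × DistanceAtMost 2 u v
    ; ~-resp-≈ =
        (λ p (d , k , k≤2 , t) → (λ q → d (trans q (sym p))) , k , k≤2 , walk-respʳ p t)
      , (λ p (d , k , k≤2 , t) → (λ q → d (trans p q)) , k , k≤2 , walk-respˡ p t)
    ; ~-sym    = λ (d , k , k≤2 , t) → (λ q → d (sym q)) , k , k≤2 , walk-reverse t
    ; ~-irrefl = λ p (d , _) → d p
    }

L² : ∀ {c ℓ a} → SimpleGraph c ℓ a → SimpleGraph (c ⊔ a) ℓ (c ⊔ ℓ ⊔ a)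
L² G = square (lineGraph G)

record OrderedGraph (c ℓ a r : Level) : Set (suc (c ⊔ ℓ ⊔ a ⊔ r)) where
  infix 4 _≺_
  field
    graph : SimpleGraph c ℓ a
  open SimpleGraph graph public
  field
    _≺_                : Rel V r
    isStrictTotalOrder : IsStrictTotalOrder _≈_ _≺_

data Pattern : Set where
  p₁ p₂ p₃ p₄ p₅ : Pattern

module _ {c ℓ a r : Level} (H : OrderedGraph c ℓ a r) where
  open OrderedGraph H

  Induces : Pattern → V → V → V → Set a
  Induces p₁ x y z = ¬ x ~ y ×   x ~ z ×   y ~ z
  Induces p₂ x y z =   x ~ y × ¬ x ~ z × ¬ y ~ z
  Induces p₃ x y z = ¬ x ~ y × ¬ x ~ z ×   y ~ z
  Induces p₄ x y z = ¬ x ~ y ×   x ~ z × ¬ y ~ z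
  Induces p₅ x y z = ¬ x ~ y × ¬ x ~ z × ¬ y ~ z

  IsFreeOf : Pattern → Set (c ⊔ a ⊔ r)
  IsFreeOf p = ∀ x y z → x ≺ y → y ≺ z → ¬ Induces p x y z

-- The positions are 0, …, n - 1 rather than 1, …, n.  An ordering in
-- particular witnesses that the graph is finite, with n vertices.
Ordering : ∀ {c ℓ a} → SimpleGraph c ℓ a → ℕ → Set (c ⊔ ℓ)
Ordering G n = Bijection (SimpleGraph.vertices G) (≡.setoid (Fin n))

module _ {c ℓ a : Level} (G : SimpleGraph c ℓ a) {n : ℕ} (σ : Ordering G n) where
  open SimpleGraph G
  open Bijection σ using (to; injective) renaming (cong to to-cong)

  Precedes : Rel V 0ℓ
  Precedes u v = to u Fin.< to v

  private
    infix 4 _≺_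
    _≺_ = Precedes

  ≺-respʳ : ∀ {u v w} → v ≈ w → u ≺ v → u ≺ w
  ≺-respʳ {u} p = ≡.subst (to u Fin.<_) (to-cong p)

  ≺-respˡ : ∀ {u v w} → v ≈ w → v ≺ u → w ≺ u
  ≺-respˡ {u} p = ≡.subst (Fin._< to u) (to-cong p)

  ≺-trans : Transitive _≺_
  ≺-trans = Fin.<-trans

  ≺-irrefl : Irreflexive _≈_ _≺_
  ≺-irrefl p = Fin.<-irrefl (to-cong p)

  ≺-compare : Trichotomous _≈_ _≺_
  ≺-compare u v with Fin.<-cmp (to u) (to v)
  ... | tri< l d g = tri< l (d ∘ to-cong) g
  ... | tri≈ l e g = tri≈ l (injective e) g
  ... | tri> l d g = tri> l (d ∘ to-cong) g

  orderedBy : OrderedGraph c ℓ a 0ℓ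
  orderedBy = record
    { graph = G
    ; _≺_   = Precedes
    ; isStrictTotalOrder = record
      { isStrictPartialOrder = record
        { isEquivalence = isEquivalence
        ; irrefl        = ≺-irrefl
        ; trans         = λ {u} {v} {w} → ≺-trans {u} {v} {w}
        ; <-resp-≈      = (λ {u} → ≺-respʳ {u}) , (λ {u} → ≺-respˡ {u})
        }
      ; compare = ≺-compare
      }
    }

  HasSortedEnds : Edge G → V → V → Set ℓ
  HasSortedEnds e a b = HasEnds G e a b × a ≺ b

  Lexicographic : V → V → V → V → Set ℓ
  Lexicographic a b u v = a ≺ u ⊎ (a ≈ u × b ≺ v)

  -- The endpoints a ≺ b and u ≺ v are determined by the two edges up to _≈_,
  -- so quantifying them existentially or universally makes no difference.
  StarPrecedes : Rel (Edge G) (c ⊔ ℓ)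
  StarPrecedes eᵢ eⱼ = ∃[ a ] ∃[ b ] ∃[ u ] ∃[ v ]
    HasSortedEnds eᵢ a b × HasSortedEnds eⱼ u v × Lexicographic a b u v

  private
    infix 4 _≺*_
    _≺*_ = StarPrecedes

  sorted : ∀ e → ∃[ a ] ∃[ b ] HasSortedEnds e a b
  sorted (edge {u} {v} u~v) with ≺-compare u v
  ... | tri< l _ _ = u , v , inj₁ (refl , refl) , l
  ... | tri≈ _ p _ = contradiction u~v (~-irrefl p)
  ... | tri> _ _ g = v , u , inj₂ (refl , refl) , g

  sorted-unique : ∀ {e a b u v} → HasSortedEnds e a b → HasSortedEnds e u v → a ≈ u × b ≈ v
  sorted-unique (inj₁ (p , q) , _) (inj₁ (r , s) , _) = trans (sym p) r , trans (sym q) s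
  sorted-unique (inj₂ (p , q) , _) (inj₂ (r , s) , _) = trans (sym q) s , trans (sym p) r
  sorted-unique {a = a} {b} {u} {v} (inj₁ (p , q) , l) (inj₂ (r , s) , m) =
    contradiction (≺-respˡ {b} {a} {v} (trans (sym p) r) l)
      (λ v≺b → Fin.<-asym m (≺-respʳ {v} {b} {u} (trans (sym q) s) v≺b))
  sorted-unique {a = a} {b} {u} {v} (inj₂ (p , q) , l) (inj₁ (r , s) , m) =
    contradiction (≺-respˡ {b} {a} {v} (trans (sym q) s) l)
      (λ v≺b → Fin.<-asym m (≺-respʳ {v} {b} {u} (trans (sym p) r) v≺b))

  lex-respˡ : ∀ {a b a′ b′ u v} → a ≈ a′ → b ≈ b′ → Lexicographic a b u v → Lexicographic a′ b′ u v
  lex-respˡ {u = u} p q (inj₁ l) = inj₁ (≺-respˡ {u} p l)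
  lex-respˡ {v = v} p q (inj₂ (r , l)) = inj₂ (trans (sym p) r , ≺-respˡ {v} q l)

  lex-trans : ∀ {a b u v x y} → Lexicographic a b u v → Lexicographic u v x y → Lexicographic a b x y
  lex-trans {a} {b} {u} {v} {x} {y} (inj₁ l) (inj₁ m) = inj₁ (≺-trans {a} {u} {x} l m)
  lex-trans {a} {b} {u} {v} {x} {y} (inj₁ l) (inj₂ (p , m)) = inj₁ (≺-respʳ {a} p l)
  lex-trans {a} {b} {u} {v} {x} {y} (inj₂ (p , l)) (inj₁ m) = inj₁ (≺-respˡ {x} (sym p) m)
  lex-trans {a} {b} {u} {v} {x} {y} (inj₂ (p , l)) (inj₂ (q , m)) =
    inj₂ (trans p q , ≺-trans {b} {v} {y} l m)

  lex-irrefl : ∀ {a b} → ¬ Lexicographic a b a b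
  lex-irrefl (inj₁ l)       = Fin.<-irrefl ≡.refl l
  lex-irrefl (inj₂ (_ , l)) = Fin.<-irrefl ≡.refl l

  lex : ∀ {e f a b u v} → HasSortedEnds e a b → HasSortedEnds f u v → e ≺* f → Lexicographic a b u v
  lex {e} {f} i j (a′ , b′ , u′ , v′ , i′ , j′ , l)
    with sorted-unique {e} i′ i | sorted-unique {f} j′ j
  ... | p , q | r , s = lexʳ (lex-respˡ p q l)
    where
    lexʳ : ∀ {a b} → Lexicographic a b u′ v′ → Lexicographic a b _ _
    lexʳ {a} (inj₁ m)     = inj₁ (≺-respʳ {a} r m)
    lexʳ {b = b} (inj₂ (t , m)) = inj₂ (trans t r , ≺-respʳ {b} s m)

  ≺*-irrefl : Irreflexive (_≈ₑ_ G) _≺*_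
  ≺*-irrefl {e} {f} p e≺*f with sorted f
  ... | _ , _ , j , m =
    lex-irrefl (lex {e} {f} (ends-resp-≈ₑ G e f p j , m) (j , m) e≺*f)

  ≺*-trans : Transitive _≺*_
  ≺*-trans {e} {f} {g} (a , b , u , v , i , j , l) m with sorted g
  ... | x , y , k = a , b , x , y , i , k , lex-trans l (lex {f} {g} j k m)

  ≺*-respʳ : ∀ {e f g} → _≈ₑ_ G f g → e ≺* f → e ≺* g
  ≺*-respʳ {e} {f} {g} p (a , b , u , v , i , (j , m) , l) =
    a , b , u , v , i , (ends-resp-≈ₑ G g f (≈ₑ-sym G f g p) j , m) , l

  ≺*-respˡ : ∀ {e f g} → _≈ₑ_ G f g → f ≺* e → g ≺* e
  ≺*-respˡ {e} {f} {g} p (a , b , u , v , (i , m) , j , l) =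
    a , b , u , v , (ends-resp-≈ₑ G g f (≈ₑ-sym G f g p) i , m) , j , l

  same-ends : ∀ {e f a b u v} → HasEnds G e a b → HasEnds G f u v →
              a ≈ u → b ≈ v → _≈ₑ_ G e f
  same-ends (inj₁ (p , q)) (inj₁ (r , s)) t w = inj₁ (trans p (trans t (sym r)) , trans q (trans w (sym s)))
  same-ends (inj₁ (p , q)) (inj₂ (r , s)) t w = inj₂ (trans p (trans t (sym s)) , trans q (trans w (sym r)))
  same-ends (inj₂ (p , q)) (inj₁ (r , s)) t w = inj₂ (trans p (trans w (sym s)) , trans q (trans t (sym r)))
  same-ends (inj₂ (p , q)) (inj₂ (r , s)) t w = inj₁ (trans p (trans w (sym r)) , trans q (trans t (sym s)))

  ≺*-compare : Trichotomous (_≈ₑ_ G) _≺*_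
  ≺*-compare e f with sorted e | sorted f
  ... | a , b , i | u , v , j = go (≺-compare a u) (≺-compare b v)
    where
    less : Lexicographic a b u v → Tri (e ≺* f) (_≈ₑ_ G e f) (f ≺* e)
    less l = tri< e≺*f (λ p → ≺*-irrefl {e} {f} p e≺*f)
               (λ f≺*e → lex-irrefl (lex-trans l (lex {f} {e} j i f≺*e)))
      where e≺*f = a , b , u , v , i , j , l
    greater : Lexicographic u v a b → Tri (e ≺* f) (_≈ₑ_ G e f) (f ≺* e)
    greater l = tri> (λ e≺*f → lex-irrefl (lex-trans l (lex {e} {f} i j e≺*f)))
                  (λ p → ≺*-irrefl {f} {e} (≈ₑ-sym G e f p) f≺*e) f≺*e
      where f≺*e = u , v , a , b , j , i , l
    go : Tri (a ≺ u) (a ≈ u) (u ≺ a) → Tri (b ≺ v) (b ≈ v) (v ≺ b) →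
         Tri (e ≺* f) (_≈ₑ_ G e f) (f ≺* e)
    go (tri< l _ _) _            = less (inj₁ l)
    go (tri> _ _ l) _            = greater (inj₁ l)
    go (tri≈ _ p _) (tri< l _ _) = less (inj₂ (p , l))
    go (tri≈ _ p _) (tri> _ _ l) = greater (inj₂ (sym p , l))
    go (tri≈ _ p _) (tri≈ _ q _) =
      tri≈ (≺*-irrefl {e} {f} e≈f) e≈f (≺*-irrefl {f} {e} (≈ₑ-sym G e f e≈f))
      where e≈f = same-ends {e} {f} (proj₁ i) (proj₁ j) p q

  star : OrderedGraph (c ⊔ a) ℓ (c ⊔ ℓ ⊔ a) (c ⊔ ℓ)
  star = record
    { graph = L² G
    ; _≺_   = StarPrecedes
    ; isStrictTotalOrder = record
      { isStrictPartialOrder = record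
        { isEquivalence = ≈ₑ-isEquivalence G
        ; irrefl        = λ {e} {f} → ≺*-irrefl {e} {f}
        ; trans         = λ {e} {f} {g} → ≺*-trans {e} {f} {g}
        ; <-resp-≈      = (λ {e} {f} {g} → ≺*-respʳ {e} {f} {g})
                        , (λ {e} {f} {g} → ≺*-respˡ {e} {f} {g})
        }
      ; compare = ≺*-compare
      }
    }

{-# OPTIONS --safe #-}

-- Write u ≃ v for "equal or adjacent".  Two distinct edges are adjacent in L² G
-- iff u ≃ v for some ends u, v of theirs.  If σ is p₂- or p₃-free, then L² G is
-- complete.  A p₄ on e ≺* f ≺* g gives a p₄ of G whose middle vertex is the lower
-- end of f, and a p₅ gives one on the three lower ends.  For p₁, if e and f both
-- touch g, then their lower ends are joined by a walk in e ∪ f ∪ g.  Short-cutting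
-- its local maxima makes it a valley, which stays at or below the lower end of f;
-- so it meets g at most in that end, and e must touch f.
module Submission where

open import Defs
open import Data.Fin.Base using (toℕ)
open import Data.Fin.Properties using (toℕ-injective)
open import Data.Nat.Base using (ℕ; _≤_; _<_; z≤n; s≤s)
open import Data.Nat.Properties
  using (≤-refl; ≤-reflexive; ≤-trans; ≤-total; <⇒≤; <-irrefl; <-≤-trans; <-trans; m≤n⇒m<n∨m≡n)
open import Data.Product.Base using (∃-syntax; _×_; _,_; proj₁; proj₂)
open import Data.Sum.Base using (_⊎_; inj₁; inj₂)
open import Function.Base using (_∘_)
open import Function.Bundles using (Bijection)
open import Level using (Level)
open import Relation.Binary.Construct.Closure.ReflexiveTransitive using (Star; ε; _◅_)
open import Relation.Binary.Core using (Rel)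
open import Relation.Binary.Definitions using (Decidable; tri<; tri≈; tri>)
open import Relation.Binary.PropositionalEquality as ≡ using (cong)
open import Relation.Binary.Structures using (IsStrictTotalOrder)
open import Relation.Nullary using (¬_; yes; no; contradiction)
open import Relation.Nullary.Decidable using (_⊎-dec_)
open import Relation.Unary using (Pred)

module _ {c ℓ a : Level} (G : SimpleGraph c ℓ a) (_~?_ : Decidable (SimpleGraph._~_ G))
         {n : ℕ} (σ : Ordering G n) where
  open SimpleGraph G
  open Bijection σ using (to; injective) renaming (cong to to-cong)

  -- Positions of vertices and the relation `≃`.

  pos : V → ℕ
  pos = toℕ ∘ to

  infix 4 _≺_ _≼_ _≃_ _∈_ _~²_ _≺*_
  _≺_ _≼_ : Rel V _
  u ≺ v = pos u < pos v
  u ≼ v = pos u ≤ pos v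

  _≃_ : Rel V _
  u ≃ v = u ≈ v ⊎ u ~ v

  _∈_ : V → Edge G → Set _
  _∈_ = _isEndOf_ G

  _~²_ : Rel (Edge G) _
  _~²_ = SimpleGraph._~_ (L² G)

  _≺*_ : Rel (Edge G) _
  _≺*_ = StarPrecedes G σ

  ≈⇒≼ : ∀ {u v} → u ≈ v → u ≼ v
  ≈⇒≼ p = ≤-reflexive (cong toℕ (to-cong p))

  ≼⇒≺⊎≈ : ∀ {u v} → u ≼ v → u ≺ v ⊎ u ≈ v
  ≼⇒≺⊎≈ p with m≤n⇒m<n∨m≡n p
  ... | inj₁ l = inj₁ l
  ... | inj₂ q = inj₂ (injective (toℕ-injective q))

  ≺⇒≉ : ∀ {u v} → u ≺ v → ¬ u ≈ v
  ≺⇒≉ l p = <-irrefl (cong toℕ (to-cong p)) l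

  ≃-sym : ∀ {u v} → u ≃ v → v ≃ u
  ≃-sym (inj₁ p) = inj₁ (sym p)
  ≃-sym (inj₂ s) = inj₂ (~-sym s)

  ≃-respˡ : ∀ {u v w} → u ≈ v → u ≃ w → v ≃ w
  ≃-respˡ p (inj₁ q) = inj₁ (trans (sym p) q)
  ≃-respˡ p (inj₂ s) = inj₂ (proj₂ ~-resp-≈ p s)

  ≃-respʳ : ∀ {u v w} → u ≈ v → w ≃ u → w ≃ v
  ≃-respʳ p = ≃-sym ∘ ≃-respˡ p ∘ ≃-sym

  ≺∧≃⇒~ : ∀ {u v} → u ≺ v → u ≃ v → u ~ v
  ≺∧≃⇒~ l (inj₁ p) = contradiction p (≺⇒≉ l)
  ≺∧≃⇒~ l (inj₂ s) = s

  _≈?_ : Decidable _≈_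
  _≈?_ = IsStrictTotalOrder._≟_ (OrderedGraph.isStrictTotalOrder (orderedBy G σ))

  _≈ₑ?_ : Decidable (_≈ₑ_ G)
  _≈ₑ?_ = IsStrictTotalOrder._≟_ (OrderedGraph.isStrictTotalOrder (star G σ))

  _≃?_ : Decidable _≃_
  u ≃? v = (u ≈? v) ⊎-dec (u ~? v)

  -- Pattern-freeness in terms of `≃`.

  Free : Pattern → Set _
  Free = IsFreeOf (orderedBy G σ)

  -- Were `u` and `w` distinct and nonadjacent, they would form a `p₁` with the later `v`; if one of
  -- them equals `v`, a hypothesis already gives the claim. This is what cuts a local maximum out of
  -- a walk.
  p₁-free⇒≃ : Free p₁ → ∀ {u v w} → u ≼ v → w ≼ v → u ≃ v → v ≃ w → u ≃ w
  p₁-free⇒≃ free {u} {v} {w} u≼v w≼v u≃v v≃w with ≼⇒≺⊎≈ u≼v | ≼⇒≺⊎≈ w≼v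
  ... | inj₂ u≈v | _        = ≃-respˡ (sym u≈v) v≃w
  ... | inj₁ _   | inj₂ w≈v = ≃-respʳ (sym w≈v) u≃v
  ... | inj₁ u≺v | inj₁ w≺v with u ≃? w | ≺-compare G σ u w
  ...   | yes u≃w | _            = u≃w
  ...   | no _    | tri≈ _ u≈w _ = inj₁ u≈w
  ...   | no u≄w  | tri< u≺w _ _ = contradiction
    (u≄w ∘ inj₂ , ≺∧≃⇒~ u≺v u≃v , ≺∧≃⇒~ w≺v (≃-sym v≃w)) (free u w v u≺w w≺v)
  ...   | no u≄w  | tri> _ _ w≺u = contradiction
    (u≄w ∘ inj₂ ∘ ~-sym , ≺∧≃⇒~ w≺v (≃-sym v≃w) , ≺∧≃⇒~ u≺v u≃v) (free w u v w≺u u≺v)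

  -- Here and in the next three lemmas an inequality may be weak wherever a negated `≃` covers the
  -- same pair: `≃` contains equality, so coinciding vertices are refuted at once.
  p₂-free⇒¬¬≃ : Free p₂ → ∀ {x y z} → x ≺ y → y ≼ z → x ≃ y → ¬ (¬ x ≃ z × ¬ y ≃ z)
  p₂-free⇒¬¬≃ free {x} {y} {z} x≺y y≼z x≃y (x≄z , y≄z) with ≼⇒≺⊎≈ y≼z
  ... | inj₁ y≺z = free x y z x≺y y≺z (≺∧≃⇒~ x≺y x≃y , x≄z ∘ inj₂ , y≄z ∘ inj₂)
  ... | inj₂ y≈z = y≄z (inj₁ y≈z)

  p₃-free⇒¬¬≃ : Free p₃ → ∀ {x y z} → x ≼ y → y ≺ z → y ≃ z → ¬ (¬ x ≃ y × ¬ x ≃ z)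
  p₃-free⇒¬¬≃ free {x} {y} {z} x≼y y≺z y≃z (x≄y , x≄z) with ≼⇒≺⊎≈ x≼y
  ... | inj₁ x≺y = free x y z x≺y y≺z (x≄y ∘ inj₂ , x≄z ∘ inj₂ , ≺∧≃⇒~ y≺z y≃z)
  ... | inj₂ x≈y = x≄y (inj₁ x≈y)

  p₄-free⇒¬¬≃ : Free p₄ → ∀ {x y z} → x ≼ y → y ≼ z → x ≃ z → ¬ (¬ x ≃ y × ¬ y ≃ z)
  p₄-free⇒¬¬≃ free {x} {y} {z} x≼y y≼z x≃z (x≄y , y≄z) with ≼⇒≺⊎≈ x≼y | ≼⇒≺⊎≈ y≼z
  ... | inj₂ x≈y | _        = x≄y (inj₁ x≈y)
  ... | inj₁ _   | inj₂ y≈z = y≄z (inj₁ y≈z)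
  ... | inj₁ x≺y | inj₁ y≺z =
    free x y z x≺y y≺z (x≄y ∘ inj₂ , ≺∧≃⇒~ (<-trans x≺y y≺z) x≃z , y≄z ∘ inj₂)

  p₅-free⇒¬¬≃ : Free p₅ → ∀ {x y z} → x ≼ y → y ≼ z → ¬ (¬ x ≃ y × ¬ x ≃ z × ¬ y ≃ z)
  p₅-free⇒¬¬≃ free {x} {y} {z} x≼y y≼z (x≄y , x≄z , y≄z) with ≼⇒≺⊎≈ x≼y | ≼⇒≺⊎≈ y≼z
  ... | inj₂ x≈y | _        = x≄y (inj₁ x≈y)
  ... | inj₁ _   | inj₂ y≈z = y≄z (inj₁ y≈z)
  ... | inj₁ x≺y | inj₁ y≺z = free x y z x≺y y≺z (x≄y ∘ inj₂ , x≄z ∘ inj₂ , y≄z ∘ inj₂)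

  -- Walks inside a set `S`, and their reduction to valleys.

  module _ {s : Level} (S : Pred V s) where

    -- Only the target is required to lie in `S`, so that removing an inner vertex of a walk leaves
    -- the other membership proofs in place.
    Link : Rel V _
    Link u v = u ≃ v × S v

    Down Up : Rel V _
    Down u v = Link u v × v ≼ u
    Up   u v = Link u v × u ≼ v

    Valley : Rel V _
    Valley u v = ∃[ m ] (Star Down u m × Star Up m v)

    valley-cons : Free p₁ → ∀ {u v m w} → Link u v → Star Down v m → Star Up m w → Valley u w
    valley-cons free {u} {v} (u≃v , Sv) ds us with ≤-total (pos v) (pos u)
    valley-cons free (u≃v , Sv) ds us | inj₁ v≼u = _ , ((u≃v , Sv) , v≼u) ◅ ds , us
    valley-cons free (u≃v , Sv) ε  us | inj₂ u≼v = _ , ε , ((u≃v , Sv) , u≼v) ◅ us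
    -- Here `v` is a local maximum between `u` and `x`, so it is cut out. The new link may again go
    -- up, hence the recursion on the shorter descent.
    valley-cons free (u≃v , Sv) (((v≃x , Sx) , x≼v) ◅ ds) us | inj₂ u≼v =
      valley-cons free (p₁-free⇒≃ free u≼v x≼v u≃v v≃x , Sx) ds us

    valley : Free p₁ → ∀ {u w} → Star Link u w → Valley u w
    valley free ε        = _ , ε , ε
    valley free (l ◅ ls) with valley free ls
    ... | _ , ds , us = valley-cons free l ds us

    ascent-≼ : ∀ {m w} → Star Up m w → m ≼ w
    ascent-≼ ε              = ≤-refl
    ascent-≼ ((_ , p) ◅ us) = ≤-trans p (ascent-≼ us)

    -- A valley that starts at or below its endpoint `w` never rises above `w`: the descent stays
    -- below its start, the ascent below its end. So `step` only has to handle targets `v ≼ w`.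
    valley-invariant : ∀ {q} (Q : Pred V q) {w} →
      (∀ {u v} → Q u → Link u v → v ≼ w → Q v) →
      ∀ {u} → Q u → u ≼ w → Valley u w → Q w
    valley-invariant Q {w} step q u≼w (_ , ds , us) = descend q u≼w ds us
      where
      ascend : ∀ {u} → Q u → Star Up u w → Q w
      ascend q ε              = q
      ascend q ((l , _) ◅ us) = ascend (step q l (ascent-≼ us)) us

      descend : ∀ {u m} → Q u → u ≼ w → Star Down u m → Star Up m w → Q w
      descend q u≼w ε              us = ascend q us
      descend q u≼w ((l , p) ◅ ds) us =
        descend (step q l (≤-trans p u≼w)) (≤-trans p u≼w) ds us

  -- Adjacency in `L² G` in terms of ends.

  ∈-respˡ : ∀ {u v} e → u ≈ v → u ∈ e → v ∈ e
  ∈-respˡ e p (inj₁ q) = inj₁ (trans (sym p) q)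
  ∈-respˡ e p (inj₂ q) = inj₂ (trans (sym p) q)

  ends-≃ : ∀ e {u v} → u ∈ e → v ∈ e → u ≃ v
  ends-≃ e (inj₁ p) (inj₁ q) = inj₁ (trans p (sym q))
  ends-≃ e (inj₁ p) (inj₂ q) = ≃-respˡ (sym p) (≃-respʳ (sym q) (inj₂ (Edge.adjacent e)))
  ends-≃ e (inj₂ p) (inj₁ q) = ≃-respˡ (sym p) (≃-respʳ (sym q) (inj₂ (~-sym (Edge.adjacent e))))
  ends-≃ e (inj₂ p) (inj₂ q) = inj₁ (trans p (sym q))

  Touch : Rel (Edge G) _
  Touch e f = ∃[ u ] ∃[ v ] (u ∈ e × v ∈ f × u ≃ v)

  -- A walk of length 1 gives a common end. In one of length 2, the middle edge contains an end of
  -- `e` and an end of `f`, which are therefore equal or adjacent.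
  adjacent⇒touch : ∀ e f → e ~² f → Touch e f
  adjacent⇒touch _ _ (e≉f , _ , _ , [] p) = contradiction p e≉f
  adjacent⇒touch e f (_ , _ , _ , _∷_ {v = g} (_ , w , w∈e , w∈g) ([] g≈f)) =
    w , w , w∈e , isEndOf-resp-≈ₑ G g f g≈f w∈g , inj₁ refl
  adjacent⇒touch e f (_ , _ , _ ,
      _∷_ {v = g} (_ , u , u∈e , u∈g) (_∷_ {v = h} (_ , v , v∈g , v∈h) ([] h≈f))) =
    u , v , u∈e , isEndOf-resp-≈ₑ G h f h≈f v∈h , ends-≃ g u∈g v∈g
  adjacent⇒touch _ _ (_ , _ , s≤s (s≤s ()) , _ ∷ _ ∷ _ ∷ _)

  meet⇒adjacent : ∀ e f {w} → ¬ _≈ₑ_ G e f → w ∈ e → w ∈ f → e ~² f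
  meet⇒adjacent e f {w} e≉f w∈e w∈f =
    e≉f , 1 , s≤s z≤n , _∷_ {v = f} (e≉f , w , w∈e , w∈f) ([] (inj₁ (refl , refl)))

  -- The edge joining the two ends is the midpoint of a walk of length 2, unless it coincides with
  -- `e` or `f`; then `e` and `f` share an end.
  touch⇒adjacent : ∀ e f → ¬ _≈ₑ_ G e f → Touch e f → e ~² f
  touch⇒adjacent e f e≉f (u , v , u∈e , v∈f , inj₁ u≈v) =
    meet⇒adjacent e f e≉f (∈-respˡ e u≈v u∈e) v∈f
  touch⇒adjacent e f e≉f (u , v , u∈e , v∈f , inj₂ u~v) with e ≈ₑ? edge u~v | edge u~v ≈ₑ? f
  ... | yes e≈g | _       =
    meet⇒adjacent e f e≉f
      (isEndOf-resp-≈ₑ G (edge u~v) e (≈ₑ-sym G e (edge u~v) e≈g) (inj₂ refl)) v∈f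
  ... | no _    | yes g≈f =
    meet⇒adjacent e f e≉f u∈e (isEndOf-resp-≈ₑ G (edge u~v) f g≈f (inj₁ refl))
  ... | no e≉g  | no g≉f  =
    e≉f , 2 , ≤-refl ,
    _∷_ {v = edge u~v} (e≉g , u , u∈e , inj₁ refl)
      (_∷_ {v = f} (g≉f , v , inj₂ refl , v∈f) ([] (inj₁ (refl , refl))))

  -- The two edges induce a `2K₂`.
  Apart : Rel (Edge G) _
  Apart e f = ∀ {u v} → u ∈ e → v ∈ f → ¬ u ≃ v

  nonadjacent⇒apart : ∀ e f → e ≺* f → ¬ e ~² f → Apart e f
  nonadjacent⇒apart e f e≺*f e≁f u∈e v∈f u≃v =
    e≁f (touch⇒adjacent e f (λ p → ≺*-irrefl G σ {e} {f} p e≺*f) (_ , _ , u∈e , v∈f , u≃v))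

  -- Lower and upper ends of an edge.

  low high : Edge G → V
  low  e = proj₁ (sorted G σ e)
  high e = proj₁ (proj₂ (sorted G σ e))

  hasSortedEnds : ∀ e → HasSortedEnds G σ e (low e) (high e)
  hasSortedEnds e = proj₂ (proj₂ (sorted G σ e))

  low≺high : ∀ e → low e ≺ high e
  low≺high e = proj₂ (hasSortedEnds e)

  low∈ : ∀ e → low e ∈ e
  low∈ e with proj₁ (hasSortedEnds e)
  ... | inj₁ (p , _) = inj₁ (sym p)
  ... | inj₂ (_ , q) = inj₂ (sym q)

  high∈ : ∀ e → high e ∈ e
  high∈ e with proj₁ (hasSortedEnds e)
  ... | inj₁ (_ , q) = inj₂ (sym q)
  ... | inj₂ (p , _) = inj₁ (sym p)

  low≃high : ∀ e → low e ≃ high e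
  low≃high e = ends-≃ e (low∈ e) (high∈ e)

  low-least : ∀ {w} e → w ∈ e → low e ≼ w
  low-least e w∈e with proj₁ (hasSortedEnds e) | w∈e
  ... | inj₁ (p , _) | inj₁ r = ≈⇒≼ (sym (trans r p))
  ... | inj₁ (_ , q) | inj₂ r = ≤-trans (<⇒≤ (low≺high e)) (≈⇒≼ (sym (trans r q)))
  ... | inj₂ (p , _) | inj₁ r = ≤-trans (<⇒≤ (low≺high e)) (≈⇒≼ (sym (trans r p)))
  ... | inj₂ (_ , q) | inj₂ r = ≈⇒≼ (sym (trans r q))

  low-mono : ∀ e f → e ≺* f → low e ≼ low f
  low-mono e f e≺*f with lex G σ {e} {f} (hasSortedEnds e) (hasSortedEnds f) e≺*f
  ... | inj₁ l       = <⇒≤ l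
  ... | inj₂ (p , _) = ≈⇒≼ p

  -- Transfer of each pattern from `σ` to the star order.

  p₁-free⇒¬apart : Free p₁ → ∀ e f g → low e ≼ low f → low f ≼ low g →
                   Touch e g → Touch f g → ¬ Apart e f
  p₁-free⇒¬apart free e f g e≼f f≼g
      (u , w , u∈e , w∈g , u≃w) (u′ , w′ , u′∈f , w′∈g , u′≃w′) apart =
    -- Membership in `e` persists along the valley, so `low f` would be an end of both `e` and `f`.
    apart (valley-invariant S (_∈ e) stay (low∈ e) e≼f (valley S free walk)) (low∈ f) (inj₁ refl)
    where
    S : Pred V _
    S v = v ∈ e ⊎ v ∈ f ⊎ v ∈ g

    walk : Star (Link S) (low e) (low f)
    walk = (ends-≃ e (low∈ e) u∈e     , inj₁ u∈e)
         ◅ (u≃w                       , inj₂ (inj₂ w∈g))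
         ◅ (ends-≃ g w∈g w′∈g         , inj₂ (inj₂ w′∈g))
         ◅ (≃-sym u′≃w′               , inj₂ (inj₁ u′∈f))
         ◅ (ends-≃ f u′∈f (low∈ f)    , inj₂ (inj₁ (low∈ f)))
         ◅ ε

    stay : ∀ {u v} → u ∈ e → Link S u v → v ≼ low f → v ∈ e
    stay u∈e (u≃v , inj₁ v∈e)        v≼f = v∈e
    stay u∈e (u≃v , inj₂ (inj₁ v∈f)) v≼f = contradiction u≃v (apart u∈e v∈f)
    -- No end of `g` precedes `low f`, so `v` could only be `low f` itself, which is apart from `e`.
    stay u∈e (u≃v , inj₂ (inj₂ v∈g)) v≼f with ≼⇒≺⊎≈ v≼f
    ... | inj₁ v≺f =
      contradiction (<-≤-trans v≺f (≤-trans f≼g (low-least g v∈g))) (<-irrefl ≡.refl)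
    ... | inj₂ v≈f = contradiction (≃-respʳ v≈f u≃v) (apart u∈e (low∈ f))

  -- The edge whose upper end is not the later one supplies the first two vertices of a `p₂`; the
  -- other upper end is the third.
  p₂-free⇒¬apart : Free p₂ → ∀ e f → ¬ Apart e f
  p₂-free⇒¬apart free e f apart with ≤-total (pos (high e)) (pos (high f))
  ... | inj₁ e≼f = p₂-free⇒¬¬≃ free (low≺high e) e≼f (low≃high e)
    (apart (low∈ e) (high∈ f) , apart (high∈ e) (high∈ f))
  ... | inj₂ f≼e = p₂-free⇒¬¬≃ free (low≺high f) f≼e (low≃high f)
    (apart (high∈ e) (low∈ f) ∘ ≃-sym , apart (high∈ e) (high∈ f) ∘ ≃-sym)

  -- Apartness would make `low e`, `low f`, `high f` a `p₃`.
  p₃-free⇒¬apart : Free p₃ → ∀ e f → low e ≼ low f → ¬ Apart e f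
  p₃-free⇒¬apart free e f e≼f apart = p₃-free⇒¬¬≃ free e≼f (low≺high f) (low≃high f)
    (apart (low∈ e) (low∈ f) , apart (low∈ e) (high∈ f))

  -- Since `low f` comes no later than any end of `g`, it lies between the touching ends `u` and
  -- `w`, or else between `low e` and `u`, which are `≃` as ends of `e`. Either way it is the middle
  -- of a `p₄`.
  p₄-free⇒¬apart : Free p₄ → ∀ e f g → low e ≼ low f → low f ≼ low g →
                   Touch e g → Apart e f → ¬ Apart f g
  p₄-free⇒¬apart free e f g e≼f f≼g (u , w , u∈e , w∈g , u≃w) e∥f f∥g
    with ≤-total (pos u) (pos (low f))
  ... | inj₁ u≼f = p₄-free⇒¬¬≃ free u≼f (≤-trans f≼g (low-least g w∈g)) u≃w
    (e∥f u∈e (low∈ f) , f∥g (low∈ f) w∈g)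
  ... | inj₂ f≼u = p₄-free⇒¬¬≃ free e≼f f≼u (ends-≃ e (low∈ e) u∈e)
    (e∥f (low∈ e) (low∈ f) , e∥f u∈e (low∈ f) ∘ ≃-sym)

  star-free : ∀ p → Free p → IsFreeOf (star G σ) p
  star-free p free e f g e≺f f≺g = refute p free
    where
    e≺g = ≺*-trans G σ {e} {f} {g} e≺f f≺g
    e≼f = low-mono e f e≺f
    f≼g = low-mono f g f≺g

    refute : ∀ p → Free p → ¬ Induces (star G σ) p e f g
    refute p₁ free (e≁f , e~g , f~g) =
      p₁-free⇒¬apart free e f g e≼f f≼g (adjacent⇒touch e g e~g) (adjacent⇒touch f g f~g)
        (nonadjacent⇒apart e f e≺f e≁f)
    refute p₂ free (_ , e≁g , _) = p₂-free⇒¬apart free e g (nonadjacent⇒apart e g e≺g e≁g)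
    refute p₃ free (e≁f , _ , _) = p₃-free⇒¬apart free e f e≼f (nonadjacent⇒apart e f e≺f e≁f)
    refute p₄ free (e≁f , e~g , f≁g) =
      p₄-free⇒¬apart free e f g e≼f f≼g (adjacent⇒touch e g e~g)
        (nonadjacent⇒apart e f e≺f e≁f) (nonadjacent⇒apart f g f≺g f≁g)
    refute p₅ free (e≁f , e≁g , f≁g) = p₅-free⇒¬¬≃ free e≼f f≼g
      ( nonadjacent⇒apart e f e≺f e≁f (low∈ e) (low∈ f)
      , nonadjacent⇒apart e g e≺g e≁g (low∈ e) (low∈ g)
      , nonadjacent⇒apart f g f≺g f≁g (low∈ f) (low∈ g)
      )

theorem3 : ∀ {c ℓ a : Level} (G : SimpleGraph c ℓ a) → Decidable (SimpleGraph._~_ G) →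
    ∀ (n : ℕ) (σ : Ordering G n) (p : Pattern) →
    IsFreeOf (orderedBy G σ) p → IsFreeOf (star G σ) p
theorem3 G _~?_ n σ = star-free G _~?_ σ
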